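{- Let $s\ge 9$ be a multiple of $3$ and let $n=6s+1$. Then the edge set of the complete graph on vertex set $\{0,1,\ldots,n-1\}$ can be partitioned into the edge sets of three circle graphs $C_1,C_2,C_3$ on $n$ vertices such that for each $i=1,2,3$, the largest diameter two subgraph of $C_i$ contains at most $2s+3$ vertices.
   Context: For an integer $n\ge 2$ and a set $S\subseteq\{1,\ldots,\lfloor n/2\rfloor\}$, the circle graph on $n$ vertices determined by $S$ is the graph with vertex set $\{0,1,\ldots,n-1\}$ in which two vertices $x,y$ are adjacent if and only if $(x-y)\bmod n\in S$ or $(y-x)\bmod n\in S$. A diameter two subgraph of a graph $G$ is a subgraph $H$ of $G$ such that for every pair of vertices $x,y$ of $H$ there is a path in $H$ joining $x$ and $y$ with at most two edges; its size is its number of vertices. -}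

module Defs where

open import Data.Nat using (ℕ; suc; _+_; _*_; _∸_; _≤_; _<_; NonZero)
open import Data.Nat.DivMod using (_%_; _/_)
open import Data.Fin using (Fin; toℕ)
open import Data.List using (List; length)
open import Data.List.Membership.Propositional using (_∈_)
open import Data.List.Relation.Unary.All using (All)
open import Data.List.Relation.Unary.Unique.Propositional using (Unique)
open import Data.Product using (Σ; ∃; _×_)
open import Data.Sum using (_⊎_)
open import Relation.Binary.PropositionalEquality using (_≡_)
open import Relation.Nullary using (¬_)

-- A graph on vertex set Fin n, given by its (symmetric, irreflexive) adjacency relation.
Graph : ℕ → Set₁
Graph n = Fin n → Fin n → Set

ValidConnSet : (n : ℕ) → List ℕ → Set
ValidConnSet n S = All (λ d → 1 ≤ d × d ≤ n / 2) S

diffMod : (n : ℕ) → .{{_ : NonZero n}} → Fin n → Fin n → ℕ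
diffMod n a b = (toℕ a + n ∸ toℕ b) % n

Circle : (n : ℕ) → .{{_ : NonZero n}} → List ℕ → Graph n
Circle n S x y = (diffMod n x y ∈ S) ⊎ (diffMod n y x ∈ S)

Complete : (n : ℕ) → Graph n
Complete n x y = ¬ (x ≡ y)

record Subgraph {n : ℕ} (G : Graph n) : Set₁ where
  field
    verts   : List (Fin n)
    uniq    : Unique verts
    edge    : Fin n → Fin n → Set
    edge-in : ∀ x y → edge x y → (x ∈ verts) × (y ∈ verts) × G x y
    edge-sym : ∀ x y → edge x y → edge y x
open Subgraph public

size : {n : ℕ} {G : Graph n} → Subgraph G → ℕ
size H = length (verts H)

DiameterTwo : {n : ℕ} {G : Graph n} → Subgraph G → Set
DiameterTwo H = ∀ x y → x ∈ verts H → y ∈ verts H →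
  (x ≡ y) ⊎ edge H x y ⊎ ∃ λ z → z ∈ verts H × edge H x z × edge H z y

EdgePartition3 : {n : ℕ} → Graph n → Graph n → Graph n → Graph n → Set
EdgePartition3 G G₁ G₂ G₃ =
  (∀ x y → G₁ x y → G x y) × (∀ x y → G₂ x y → G x y) × (∀ x y → G₃ x y → G x y) ×
  (∀ x y → G x y → G₁ x y ⊎ G₂ x y ⊎ G₃ x y) ×
  (∀ x y → ¬ (G₁ x y × G₂ x y)) × (∀ x y → ¬ (G₁ x y × G₃ x y)) × (∀ x y → ¬ (G₂ x y × G₃ x y))

MaxDiam2AtMost : {n : ℕ} → Graph n → ℕ → Set₁
MaxDiam2AtMost G m = (H : Subgraph G) → DiameterTwo H → size H ≤ m

{-# OPTIONS --safe #-}

-- Write s = 3t, so n = 18t + 1, and split the distances 1, …, 9t into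
--   S₁ = [1, 3t],   S₂ = [3t + 1, 5t] ∪ [8t + 1, 9t],   S₃ = [5t + 1, 8t].
-- The vertex set A of a diameter two subgraph contains no two points whose difference is neither
-- ± an element of S nor a sum of two such; so it avoids the differences in [6t + 1, 12t] for S₁,
-- in [2t, 3t] for S₂ and in [8t + 1, 10t] for S₃.
--
-- For S₁, the points after p ∈ A are paired by the difference 12t, which gives |A| ≤ 6t + 1.
-- For S₂ and S₃ use that A is disjoint from A + [u, v] when the differences in [u, v] are avoided.
-- This sumset has at least |A| + k (v - u) points if k gaps of A are longer than v - u, whence
-- 2 |A| + k (v - u) ≤ n.  If |A| ≥ 6t + 4 for S₂, all gaps are shorter than 2t, and then there are
-- at least 6 gaps longer than t, a contradiction.  For S₃ either there are 3 long gaps or A lies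
-- in an arc of length 8t, in which the middle 2t + 1 places cannot be used.
module Submission where

open import Defs
open import Data.Empty using (⊥; ⊥-elim)
open import Data.Fin using (Fin; toℕ)
open import Data.Fin.Properties using (toℕ-injective; toℕ<n)
open import Data.List using (List; []; _∷_; _++_; applyUpTo; length)
open import Data.List.Membership.Propositional using (_∈_)
open import Data.List.Membership.Propositional.Properties
  using (∈-applyUpTo⁺; ∈-applyUpTo⁻; ∈-++⁺ˡ; ∈-++⁺ʳ; ∈-++⁻)
open import Data.List.Relation.Unary.All as All using ()
open import Data.List.Relation.Unary.AllPairs using ([]; _∷_)
open import Data.List.Relation.Unary.Any using (here; there)
open import Data.List.Relation.Unary.Unique.Propositional using (Unique)
open import Data.Nat
open import Data.Nat.DivMod
open import Data.Nat.Divisibility using (_∣_; divides)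
open import Data.Nat.Properties
open import Data.Nat.Tactic.RingSolver using (solve)
open import Data.Product using (Σ; ∃-syntax; _×_; _,_; proj₁)
open import Data.Sum as Sum using (_⊎_; inj₁; inj₂; [_,_]′)
open import Relation.Binary.Definitions using (tri<; tri≈; tri>)
open import Relation.Binary.PropositionalEquality
open import Relation.Nullary using (¬_; yes; no)

-- Certificates for linear inequalities

infixl 5 _⊕_
_⊕_ : ∀ {a b c d} → a ≤ b → c ≤ d → a + c ≤ b + d
_⊕_ = +-mono-≤

-- Linear arithmetic by certificate: add up the available inequalities with _⊕_ to get a ≤ b, and
-- check that it yields x ≤ y with slack k.
by : ∀ {a b x y} k → a ≤ b → a + y ≡ b + x + k → x ≤ y
by {a} {b} {x} {y} k a≤b eq = ≤-trans (m≤m+n x k) (+-cancelˡ-≤ b (x + k) y (begin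
  b + (x + k)  ≡⟨ +-assoc b x k ⟨
  b + x + k    ≡⟨ eq ⟨
  a + y        ≤⟨ +-monoˡ-≤ y a≤b ⟩
  b + y        ∎))
  where open ≤-Reasoning

absurd : ∀ {a b} k → a ≤ b → a ≡ b + suc k → ∀ {ℓ} {X : Set ℓ} → X
absurd {a} {b} k a≤b eq = ⊥-elim (m+1+n≰m b (subst (_≤ b) eq a≤b))

zero? : ∀ m → m ≡ 0 ⊎ 0 < m
zero? zero    = inj₁ refl
zero? (suc m) = inj₂ z<s

-- Counting over windows of natural numbers

count : (ℕ → ℕ) → ℕ → ℕ → ℕ
count f x zero    = 0
count f x (suc w) = f x + count f (suc x) w

module _ (f : ℕ → ℕ) where

  count-++ : ∀ x a b → count f x (a + b) ≡ count f x a + count f (x + a) b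
  count-++ x zero    b = cong (λ y → count f y b) (sym (+-identityʳ x))
  count-++ x (suc a) b rewrite count-++ (suc x) a b | +-suc x a =
    sym (+-assoc (f x) (count f (suc x) a) _)

  count-empty : ∀ x w → (∀ z → x ≤ z → z < x + w → f z ≡ 0) → count f x w ≡ 0
  count-empty x zero    e = refl
  count-empty x (suc w) e = cong₂ _+_
    (e x ≤-refl (m<m+n x z<s))
    (count-empty (suc x) w λ z x<z z< →
      e z (<⇒≤ x<z) (subst (z <_) (sym (+-suc x w)) z<))

  count≤ : (∀ z → f z ≤ 1) → ∀ x w → count f x w ≤ w
  count≤ f≤1 x zero    = z≤n
  count≤ f≤1 x (suc w) = f≤1 x ⊕ count≤ f≤1 (suc x) w

  count-monoʳ : ∀ x {v w} → v ≤ w → count f x v ≤ count f x w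
  count-monoʳ x {v} v≤w with k , refl ← m≤n⇒∃[o]m+o≡n v≤w
    rewrite count-++ x v k = m≤m+n _ _

  first : ∀ x w →
    (∃[ y ] x ≤ y × y < x + w × 0 < f y × (∀ z → x ≤ z → z < y → f z ≡ 0))
      ⊎ (∀ z → x ≤ z → z < x + w → f z ≡ 0)
  first x zero = inj₂ λ z x≤z z< → ⊥-elim (<⇒≱ (subst (z <_) (+-identityʳ x) z<) x≤z)
  first x (suc w) with zero? (f x)
  ... | inj₂ 0<fx = inj₁ (x , ≤-refl , m<m+n x z<s , 0<fx , λ z x≤z z<x → ⊥-elim (<⇒≱ z<x x≤z))
  ... | inj₁ fx≡0 with first (suc x) w
  ...   | inj₁ (y , x<y , y< , 0<fy , e) =
            inj₁ (y , <⇒≤ x<y , subst (y <_) (sym (+-suc x w)) y< , 0<fy , extend)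
    where
    extend : ∀ z → x ≤ z → z < y → f z ≡ 0
    extend z x≤z z<y with m≤n⇒m<n∨m≡n x≤z
    ... | inj₁ x<z  = e z x<z z<y
    ... | inj₂ refl = fx≡0
  ...   | inj₂ e = inj₂ extend
    where
    extend : ∀ z → x ≤ z → z < x + suc w → f z ≡ 0
    extend z x≤z z< with m≤n⇒m<n∨m≡n x≤z
    ... | inj₁ x<z  = e z x<z (subst (z <_) (+-suc x w) z<)
    ... | inj₂ refl = fx≡0

count-+ : ∀ f g x w → count (λ z → f z + g z) x w ≡ count f x w + count g x w
count-+ f g x zero    = refl
count-+ f g x (suc w) rewrite count-+ f g (suc x) w =
  lemma (f x) (g x) (count f (suc x) w) (count g (suc x) w)
  where
  lemma : ∀ a b c d → a + b + (c + d) ≡ a + c + (b + d)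
  lemma a b c d = solve (a ∷ b ∷ c ∷ d ∷ [])

count-shift : ∀ f u x w → count (λ z → f (z + u)) x w ≡ count f (x + u) w
count-shift f u x zero    = refl
count-shift f u x (suc w) = cong (f (x + u) +_) (count-shift f u (suc x) w)

-- Cyclic sets with forbidden differences

-- A set of integers modulo n, given by its n-periodic indicator function.
module CyclicSet (χ : ℕ → ℕ) (χ≤1 : ∀ i → χ i ≤ 1)
                 (n : ℕ) (periodic : ∀ i → χ (i + n) ≡ χ i) where

  size# : ℕ
  size# = count χ 0 n

  -- Moving the window on by one place loses `χ x` and gains `χ (x + n)`, which has the same value.
  count-period : ∀ x → count χ x n ≡ size#
  count-period zero    = refl
  count-period (suc x) = trans (+-cancelˡ-≡ (χ x) _ _ (begin
    χ x + count χ (suc x) n  ≡⟨ cong (count χ x) (+-comm 1 n) ⟩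
    count χ x (n + 1)        ≡⟨ count-++ χ x n 1 ⟩
    count χ x n + (χ (x + n) + 0) ≡⟨ cong (count χ x n +_) (trans (+-identityʳ _) (periodic x)) ⟩
    count χ x n + χ x        ≡⟨ +-comm _ (χ x) ⟩
    χ x + count χ x n        ∎)) (count-period x)
    where open ≡-Reasoning

  Empty : ℕ → ℕ → Set
  Empty x y = ∀ z → x ≤ z → z < y → χ z ≡ 0

  -- Differences are taken between representatives `i` and `j` in `ℕ`; periodicity of `χ` makes this
  -- a condition modulo `n`.
  Forbids : ℕ → ℕ → Set
  Forbids u v = ∀ i j → i + u ≤ j → j ≤ i + v → 0 < χ i → χ j ≡ 0

  χ-absurd : ∀ {i} → 0 < χ i → χ i ≡ 0 → ∀ {ℓ} {X : Set ℓ} → X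
  χ-absurd 0<χ χ≡0 = ⊥-elim (<⇒≢ 0<χ (sym χ≡0))

  Empty-period : ∀ {x y} → Empty x y → Empty (x + n) (y + n)
  Empty-period {x} {y} e z x+n≤z z<y+n with k , refl ← m≤n⇒∃[o]m+o≡n x+n≤z =
    subst (λ i → χ i ≡ 0) x+k+n≡z
      (trans (periodic (x + k))
        (e (x + k) (m≤m+n x k) (+-cancelʳ-< n (x + k) y (subst (_< y + n) (sym x+k+n≡z) z<y+n))))
    where
    x+k+n≡z : x + k + n ≡ x + n + k
    x+k+n≡z = solve (x ∷ k ∷ n ∷ [])

  exclusive : ∀ {u v} → Forbids u v → ∀ {d} → u ≤ d → d ≤ v → ∀ i → χ i + χ (i + d) ≤ 1
  exclusive forb {d} u≤d d≤v i with zero? (χ i)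
  ... | inj₁ χi≡0 rewrite χi≡0 = χ≤1 (i + d)
  ... | inj₂ 0<χi
    rewrite forb i (i + d) (+-monoʳ-≤ i u≤d) (+-monoʳ-≤ i d≤v) 0<χi | +-identityʳ (χ i) = χ≤1 i

  -- After the element p, pair p + 1 + j with p + 1 + j + (a + g) for j < a; the rest is forbidden.
  window-at : ∀ a g → 1 ≤ g → Forbids (suc a) (a + g) → ∀ p → 0 < χ p →
    count χ p (suc a + (a + g)) ≤ suc a
  window-at a g 1≤g forb p 0<χp = begin
    count χ p (suc a + (a + g))
      ≡⟨ cong (λ w → χ p + count χ (suc p) (a + w)) (+-comm a g) ⟩
    χ p + count χ (suc p) (a + (g + a))
      ≡⟨ cong (χ p +_) (trans (count-++ χ (suc p) a (g + a))
           (cong (count χ (suc p) a +_) (count-++ χ (suc p + a) g a))) ⟩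
    χ p + (count χ (suc p) a + (count χ (suc p + a) g + count χ (suc p + a + g) a))
      ≡⟨ cong (λ m → χ p + (count χ (suc p) a + (m + count χ (suc p + a + g) a))) (count-empty χ _ g middle) ⟩
    χ p + (count χ (suc p) a + count χ (suc p + a + g) a)
      ≡⟨ cong (λ y → χ p + (count χ (suc p) a + count χ y a)) (+-assoc (suc p) a g) ⟩
    χ p + (count χ (suc p) a + count χ (suc p + (a + g)) a)
      ≡⟨ cong (λ m → χ p + (count χ (suc p) a + m)) (count-shift χ (a + g) (suc p) a) ⟨
    χ p + (count χ (suc p) a + count (λ z → χ (z + (a + g))) (suc p) a)
      ≡⟨ cong (χ p +_) (count-+ χ _ (suc p) a) ⟨
    χ p + count (λ z → χ z + χ (z + (a + g))) (suc p) a
      ≤⟨ χ≤1 p ⊕ count≤ _ (exclusive forb (m<m+n a 1≤g) ≤-refl) (suc p) a ⟩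
    suc a ∎
    where
    open ≤-Reasoning
    middle : Empty (suc p + a) (suc p + a + g)
    middle z lo hi = forb p z
      (by 0 lo (solve (p ∷ a ∷ z ∷ [])))
      (by 0 hi (solve (p ∷ a ∷ g ∷ z ∷ []))) 0<χp

  -- Non-elements at the start are dropped until the window begins at an element, where `window-at`
  -- applies. Shorter windows are allowed for the sake of this induction.
  window : ∀ a g → 1 ≤ g → Forbids (suc a) (a + g) → ∀ x w → w ≤ suc a + (a + g) →
    count χ x w ≤ suc a
  window a g 1≤g forb x zero    w≤ = z≤n
  window a g 1≤g forb x (suc w) w≤ with zero? (χ x)
  ... | inj₂ 0<χx = ≤-trans (count-monoʳ χ x w≤) (window-at a g 1≤g forb x 0<χx)
  ... | inj₁ χx≡0 rewrite χx≡0 = window a g 1≤g forb (suc x) w (<⇒≤ w≤)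

  -- The set and its translate by u are disjoint, and both miss the g places z, …, z + g − 1 when
  -- z + (u + g) is an element preceded by g non-elements (a front).  Hence each front of the set
  -- saves g in the bound  2 · size# ≤ n.
  module Fronts (u g : ℕ) (forb : Forbids u (u + g)) where

    Front : ℕ → Set
    Front z = 0 < χ (z + (u + g)) × Empty (z + u) (z + (u + g))

    ψ : ℕ → ℕ
    ψ z = χ z + χ (z + u)

    -- Since `ψ` is at most 1, this says that at least `k * g` places `z` in [x, y) have neither `z`
    -- nor `z + u` in the set. The length `w` replaces a subtraction.
    Saves : ℕ → ℕ → ℕ → Set
    Saves k x y = ∃[ w ] x + w ≡ y × count ψ x w + k * g ≤ w

    saves-none : ∀ x → Saves 0 x x
    saves-none x = 0 , +-identityʳ x , z≤n

    ψ≤1 : ∀ z → ψ z ≤ 1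
    ψ≤1 = exclusive forb ≤-refl (m≤m+n u g)

    -- For `i` in [z, z + g), the place `i + u` lies in the gap of the front, and `i` itself is at a
    -- forbidden distance, between `u + 1` and `u + g`, from the element `z + (u + g)`.
    front-ψ : ∀ {z} → Front z → ∀ i → z ≤ i → i < z + g → ψ i ≡ 0
    front-ψ {z} (0<χ , e) i z≤i i<z+g = cong₂ _+_ χi≡0
      (e (i + u) (+-monoˡ-≤ u z≤i) (by 0 i<z+g (solve (z ∷ i ∷ u ∷ g ∷ []))))
      where
      χi≡0 : χ i ≡ 0
      χi≡0 with zero? (χ i)
      ... | inj₁ χi≡0 = χi≡0
      ... | inj₂ 0<χi = χ-absurd 0<χ (forb i (z + (u + g))
              (by 1 i<z+g (solve (z ∷ i ∷ u ∷ g ∷ [])))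
              (by 0 z≤i (solve (z ∷ i ∷ u ∷ g ∷ []))) 0<χi)

    -- The `g` places from `y` on contribute nothing to the count of `ψ`, and each place between
    -- `y + g` and `y′` at most 1.
    saves-front : ∀ {k x y y′} → Saves k x y → Front y → y + g ≤ y′ → Saves (suc k) x y′
    saves-front {k} {x} (w , refl , s) front y+g≤y′ with v , refl ← m≤n⇒∃[o]m+o≡n y+g≤y′ =
      w + (g + v) , solve (x ∷ w ∷ g ∷ v ∷ []) , (begin
        count ψ x (w + (g + v)) + (g + k * g)
          ≡⟨ cong (_+ _) (trans (count-++ ψ x w (g + v))
               (cong (count ψ x w +_) (count-++ ψ (x + w) g v))) ⟩
        count ψ x w + (count ψ (x + w) g + count ψ (x + w + g) v) + (g + k * g)
          ≡⟨ cong (λ m → count ψ x w + (m + count ψ (x + w + g) v) + (g + k * g))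
               (count-empty ψ (x + w) g (front-ψ front)) ⟩
        count ψ x w + count ψ (x + w + g) v + (g + k * g)
          ≤⟨ +-monoˡ-≤ (g + k * g) (+-monoʳ-≤ (count ψ x w) (count≤ ψ ψ≤1 (x + w + g) v)) ⟩
        count ψ x w + v + (g + k * g)
          ≡⟨ lemma (count ψ x w) v g (k * g) ⟩
        count ψ x w + k * g + (g + v)
          ≤⟨ +-monoˡ-≤ (g + v) s ⟩
        w + (g + v) ∎)
      where
      open ≤-Reasoning
      lemma : ∀ c v g h → c + v + (g + h) ≡ c + h + (g + v)
      lemma c v g h = solve (c ∷ v ∷ g ∷ h ∷ [])

    -- Otherwise the element that ends the gap of `z` would lie inside the gap of `z′`.
    front-sep : ∀ {z z′} → Front z → Front z′ → z < z′ → z + g ≤ z′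
    front-sep {z} {z′} (0<χ , _) (_ , e) z<z′ with z + g ≤? z′
    ... | yes z+g≤z′ = z+g≤z′
    ... | no  z+g≰z′ = χ-absurd 0<χ (e (z + (u + g))
            (by 1 (≰⇒> z+g≰z′) (solve (z ∷ z′ ∷ u ∷ g ∷ [])))
            (by 0 z<z′ (solve (z ∷ z′ ∷ u ∷ g ∷ []))))

    front-period : ∀ {z} → Front z → Front (z + n)
    front-period {z} (0<χ , e) =
      subst (λ i → 0 < χ i) (shift (u + g)) (subst (0 <_) (sym (periodic (z + (u + g)))) 0<χ) ,
      subst₂ Empty (shift u) (shift (u + g)) (Empty-period e)
      where
      shift : ∀ v → z + v + n ≡ z + n + v
      shift v = solve (z ∷ v ∷ n ∷ [])

    -- Over a full period `ψ` counts every element twice; the places from `y` to the end of the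
    -- period count at most 1 each.
    saves-bound : ∀ {k x y} → Saves k x y → y ≤ x + n → size# + size# + k * g ≤ n
    saves-bound {k} {x} (w , refl , s) y≤ with v , refl ← m≤n⇒∃[o]m+o≡n (+-cancelˡ-≤ x w n y≤) = begin
      size# + size# + k * g
        ≡⟨ cong (_+ k * g) (cong₂ _+_ (count-period x) (count-period (x + u))) ⟨
      count χ x (w + v) + count χ (x + u) (w + v) + k * g
        ≡⟨ cong (λ m → count χ x (w + v) + m + k * g) (count-shift χ u x (w + v)) ⟨
      count χ x (w + v) + count (λ z → χ (z + u)) x (w + v) + k * g
        ≡⟨ cong (_+ k * g) (count-+ χ _ x (w + v)) ⟨
      count ψ x (w + v) + k * g
        ≡⟨ cong (_+ k * g) (count-++ ψ x w v) ⟩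
      count ψ x w + count ψ (x + w) v + k * g
        ≡⟨ lemma (count ψ x w) (count ψ (x + w) v) (k * g) ⟩
      count ψ x w + k * g + count ψ (x + w) v
        ≤⟨ s ⊕ count≤ ψ ψ≤1 (x + w) v ⟩
      w + v ∎
      where
      open ≤-Reasoning
      lemma : ∀ a b c → a + b + c ≡ a + c + b
      lemma a b c = solve (a ∷ b ∷ c ∷ [])

-- The three distance sets and the sums of two steps

Within : ℕ → ℕ → ℕ → Set
Within a b d = a ≤ d × d ≤ b

M₁ M₂ M₃ : ℕ → ℕ → Set
M₁ t d = Within 1 (3 * t) d
M₂ t d = Within (1 + 3 * t) (5 * t) d ⊎ Within (1 + 8 * t) (9 * t) d
M₃ t d = Within (1 + 5 * t) (8 * t) d

-- The lengths, as forward steps modulo n, of edges at a distance in M.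
Mirrored : ℕ → (ℕ → Set) → ℕ → Set
Mirrored n M e = M e ⊎ ∃[ e′ ] M e′ × e + e′ ≡ n

module _ (t : ℕ) where

  mirrored₁ : ∀ {e} → Mirrored (1 + 18 * t) (M₁ t) e → Within 1 (3 * t) e ⊎ Within (1 + 15 * t) (18 * t) e
  mirrored₁ (inj₁ m) = inj₁ m
  mirrored₁ {e} (inj₂ (e′ , (lo , hi) , eq)) = inj₂
    ( by 0 (≤-reflexive (sym eq) ⊕ hi) (solve (t ∷ e ∷ e′ ∷ []))
    , by 0 (≤-reflexive eq ⊕ lo) (solve (t ∷ e ∷ e′ ∷ [])))

  -- The interval [8t + 1, 9t] and its mirror image [9t + 1, 10t] are adjacent and merge into one.
  mirrored₂ : ∀ {e} → Mirrored (1 + 18 * t) (M₂ t) e →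
    Within (1 + 3 * t) (5 * t) e ⊎ Within (1 + 8 * t) (10 * t) e ⊎ Within (1 + 13 * t) (15 * t) e
  mirrored₂ (inj₁ (inj₁ m)) = inj₁ m
  mirrored₂ {e} (inj₁ (inj₂ (lo , hi))) = inj₂ (inj₁ (lo , by t hi (solve (t ∷ e ∷ []))))
  mirrored₂ {e} (inj₂ (e′ , inj₁ (lo , hi) , eq)) = inj₂ (inj₂
    ( by 0 (≤-reflexive (sym eq) ⊕ hi) (solve (t ∷ e ∷ e′ ∷ []))
    , by 0 (≤-reflexive eq ⊕ lo) (solve (t ∷ e ∷ e′ ∷ []))))
  mirrored₂ {e} (inj₂ (e′ , inj₂ (lo , hi) , eq)) = inj₂ (inj₁
    ( by t (≤-reflexive (sym eq) ⊕ hi) (solve (t ∷ e ∷ e′ ∷ []))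
    , by 0 (≤-reflexive eq ⊕ lo) (solve (t ∷ e ∷ e′ ∷ []))))

  mirrored₃ : ∀ {e} → Mirrored (1 + 18 * t) (M₃ t) e → Within (1 + 5 * t) (8 * t) e ⊎ Within (1 + 10 * t) (13 * t) e
  mirrored₃ (inj₁ m) = inj₁ m
  mirrored₃ {e} (inj₂ (e′ , (lo , hi) , eq)) = inj₂
    ( by 0 (≤-reflexive (sym eq) ⊕ hi) (solve (t ∷ e ∷ e′ ∷ []))
    , by 0 (≤-reflexive eq ⊕ lo) (solve (t ∷ e ∷ e′ ∷ [])))

  -- This coarse range is enough for sums: they lie in [10t + 2, 26t], hence modulo n outside
  -- [8t + 1, 10t].
  hull₃ : ∀ {e} → Mirrored (1 + 18 * t) (M₃ t) e → Within (1 + 5 * t) (13 * t) e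
  hull₃ {e} m with mirrored₃ m
  ... | inj₁ (lo , hi) = lo , by (5 * t) hi (solve (t ∷ e ∷ []))
  ... | inj₂ (lo , hi) = by (5 * t) lo (solve (t ∷ e ∷ [])) , hi

  -- Modulo n = 18t + 1 the three ranges end at 6t, run from 15t + 1 around to 3t - 1, and begin at
  -- 12t + 1, so [6t + 1, 12t] is missed.
  sum₁ : ∀ {e e′} → Mirrored (1 + 18 * t) (M₁ t) e → Mirrored (1 + 18 * t) (M₁ t) e′ →
    e + e′ ≤ 6 * t ⊎ Within (1 + 15 * t) (21 * t) (e + e′) ⊎ 2 + 30 * t ≤ e + e′
  sum₁ {e} {e′} m m′ with mirrored₁ m | mirrored₁ m′
  ... | inj₁ (lo , hi) | inj₁ (lo′ , hi′) = inj₁ (by 0 (hi ⊕ hi′) (solve (t ∷ e ∷ e′ ∷ [])))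
  ... | inj₁ (lo , hi) | inj₂ (lo′ , hi′) = inj₂ (inj₁
        ( by 1 (lo ⊕ lo′) (solve (t ∷ e ∷ e′ ∷ [])) , by 0 (hi ⊕ hi′) (solve (t ∷ e ∷ e′ ∷ []))))
  ... | inj₂ (lo , hi) | inj₁ (lo′ , hi′) = inj₂ (inj₁
        ( by 1 (lo ⊕ lo′) (solve (t ∷ e ∷ e′ ∷ [])) , by 0 (hi ⊕ hi′) (solve (t ∷ e ∷ e′ ∷ []))))
  ... | inj₂ (lo , hi) | inj₂ (lo′ , hi′) = inj₂ (inj₂ (by 0 (lo ⊕ lo′) (solve (t ∷ e ∷ e′ ∷ []))))

  -- Modulo n the bound 20t becomes 2t - 1 and 21t + 2 becomes 3t + 1, so [2t, 3t] is missed.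
  sum₂ : ∀ {e e′} → Mirrored (1 + 18 * t) (M₂ t) e → Mirrored (1 + 18 * t) (M₂ t) e′ →
    Within (1 + 6 * t) (20 * t) (e + e′) ⊎ 2 + 21 * t ≤ e + e′
  sum₂ {e} {e′} m m′ with mirrored₂ m | mirrored₂ m′
  ... | inj₁ (lo , hi)        | inj₁ (lo′ , hi′) = inj₁
        ( by 1 (lo ⊕ lo′) (solve (t ∷ e ∷ e′ ∷ [])) , by (10 * t) (hi ⊕ hi′) (solve (t ∷ e ∷ e′ ∷ [])))
  ... | inj₁ (lo , hi)        | inj₂ (inj₁ (lo′ , hi′)) = inj₁
        ( by (1 + 5 * t) (lo ⊕ lo′) (solve (t ∷ e ∷ e′ ∷ [])) , by (5 * t) (hi ⊕ hi′) (solve (t ∷ e ∷ e′ ∷ [])))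
  ... | inj₁ (lo , hi)        | inj₂ (inj₂ (lo′ , hi′)) = inj₁
        ( by (1 + 10 * t) (lo ⊕ lo′) (solve (t ∷ e ∷ e′ ∷ [])) , by 0 (hi ⊕ hi′) (solve (t ∷ e ∷ e′ ∷ [])))
  ... | inj₂ (inj₁ (lo , hi)) | inj₁ (lo′ , hi′) = inj₁
        ( by (1 + 5 * t) (lo ⊕ lo′) (solve (t ∷ e ∷ e′ ∷ [])) , by (5 * t) (hi ⊕ hi′) (solve (t ∷ e ∷ e′ ∷ [])))
  ... | inj₂ (inj₁ (lo , hi)) | inj₂ (inj₁ (lo′ , hi′)) = inj₁
        ( by (1 + 10 * t) (lo ⊕ lo′) (solve (t ∷ e ∷ e′ ∷ [])) , by 0 (hi ⊕ hi′) (solve (t ∷ e ∷ e′ ∷ [])))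
  ... | inj₂ (inj₁ (lo , hi)) | inj₂ (inj₂ (lo′ , hi′)) =
        inj₂ (by 0 (lo ⊕ lo′) (solve (t ∷ e ∷ e′ ∷ [])))
  ... | inj₂ (inj₂ (lo , hi)) | inj₁ (lo′ , hi′) = inj₁
        ( by (1 + 10 * t) (lo ⊕ lo′) (solve (t ∷ e ∷ e′ ∷ [])) , by 0 (hi ⊕ hi′) (solve (t ∷ e ∷ e′ ∷ [])))
  ... | inj₂ (inj₂ (lo , hi)) | inj₂ (inj₁ (lo′ , hi′)) =
        inj₂ (by 0 (lo ⊕ lo′) (solve (t ∷ e ∷ e′ ∷ [])))
  ... | inj₂ (inj₂ (lo , hi)) | inj₂ (inj₂ (lo′ , hi′)) =
        inj₂ (by (5 * t) (lo ⊕ lo′) (solve (t ∷ e ∷ e′ ∷ [])))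

  lower₂ : ∀ {e} → Mirrored (1 + 18 * t) (M₂ t) e → 1 + 3 * t ≤ e
  lower₂ {e} m with mirrored₂ m
  ... | inj₁ (lo , _)        = lo
  ... | inj₂ (inj₁ (lo , _)) = by (5 * t) lo (solve (t ∷ e ∷ []))
  ... | inj₂ (inj₂ (lo , _)) = by (10 * t) lo (solve (t ∷ e ∷ []))

  -- Cyclic sets in which any two elements are joined by at most two steps

  module _ (χ : ℕ → ℕ) (χ≤1 : ∀ i → χ i ≤ 1) (periodic : ∀ i → χ (i + (1 + 18 * t)) ≡ χ i) where

    open CyclicSet χ χ≤1 (1 + 18 * t) periodic

    -- Two lengths below n that lead from `i` to `i + d` modulo n add up to `d` or `d + n`. The
    -- midpoint is recorded as an element because `arc-middle` argues about its position.
    TwoStep : (ℕ → Set) → ℕ → ℕ → Set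
    TwoStep E i d =
      d ≡ 0 ⊎ E d ⊎ ∃[ e ] ∃[ e′ ] E e × E e′ × 0 < χ (i + e) × (e + e′ ≡ d ⊎ e + e′ ≡ d + (1 + 18 * t))

    Diam2 : (ℕ → Set) → Set
    Diam2 E = ∀ i d → d < 1 + 18 * t → 0 < χ i → 0 < χ (i + d) → TwoStep E i d

    forbids : ∀ {E u v} → Diam2 E → v < 1 + 18 * t →
      (∀ {d} → u ≤ d → d ≤ v → ∀ i → ¬ TwoStep E i d) → Forbids u v
    forbids {E} {u} {v} diam v<n no-steps i j i+u≤j j≤i+v 0<χi
      with d , refl ← m≤n⇒∃[o]m+o≡n (≤-trans (m≤m+n i u) i+u≤j)
      with zero? (χ (i + d))
    ... | inj₁ χj≡0 = χj≡0
    ... | inj₂ 0<χj = ⊥-elim (no-steps (+-cancelˡ-≤ i u d i+u≤j) d≤v i (diam i d (≤-<-trans d≤v v<n) 0<χi 0<χj))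
      where
      d≤v : d ≤ v
      d≤v = +-cancelˡ-≤ i d v j≤i+v

    -- The first distance set

    bound₁ : 1 ≤ t → Diam2 (Mirrored (1 + 18 * t) (M₁ t)) → size# ≤ 6 * t + 3
    bound₁ 1≤t diam with first χ 0 (1 + 18 * t)
    ... | inj₂ e rewrite count-empty χ 0 (1 + 18 * t) e = z≤n
    ... | inj₁ (p , _ , _ , 0<χp , _) = begin
        size#
          ≡⟨ count-period p ⟨
        count χ p (1 + 18 * t)
          -- With `a = g = 6 * t` in `window-at`, the window after `p` is exactly one period.
          ≡⟨ cong (count χ p) {1 + 18 * t} {1 + (6 * t + (6 * t + 6 * t))} (solve (t ∷ [])) ⟩
        count χ p (suc (6 * t) + (6 * t + 6 * t))
          ≤⟨ window-at (6 * t) (6 * t) (by (5 * t) 1≤t (solve (t ∷ []))) forb p 0<χp ⟩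
        suc (6 * t)
          ≡⟨ +-comm 1 (6 * t) ⟩
        6 * t + 1
          ≤⟨ +-monoʳ-≤ (6 * t) (s≤s z≤n) ⟩
        6 * t + 3 ∎
      where
      open ≤-Reasoning
      no-steps : ∀ {d} → 1 + 6 * t ≤ d → d ≤ 6 * t + 6 * t → ∀ i → ¬ TwoStep (Mirrored (1 + 18 * t) (M₁ t)) i d
      no-steps {d} lo hi i (inj₁ eq) = absurd (6 * t) (lo ⊕ ≤-reflexive eq) (solve (t ∷ d ∷ []))
      no-steps {d} lo hi i (inj₂ (inj₁ m)) with mirrored₁ m
      ... | inj₁ (_ , hi′) = absurd (3 * t) (lo ⊕ hi′) (solve (t ∷ d ∷ []))
      ... | inj₂ (lo′ , _) = absurd (3 * t) (hi ⊕ lo′) (solve (t ∷ d ∷ []))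
      no-steps {d} lo hi i (inj₂ (inj₂ (e , e′ , m , m′ , _ , inj₁ eq))) with sum₁ m m′
      ... | inj₁ hi′ = absurd 0 (lo ⊕ hi′ ⊕ ≤-reflexive (sym eq)) (solve (t ∷ d ∷ e ∷ e′ ∷ []))
      ... | inj₂ (inj₁ (lo′ , _)) = absurd (3 * t) (hi ⊕ lo′ ⊕ ≤-reflexive eq) (solve (t ∷ d ∷ e ∷ e′ ∷ []))
      ... | inj₂ (inj₂ lo′) = absurd (1 + 18 * t) (hi ⊕ lo′ ⊕ ≤-reflexive eq) (solve (t ∷ d ∷ e ∷ e′ ∷ []))
      no-steps {d} lo hi i (inj₂ (inj₂ (e , e′ , m , m′ , _ , inj₂ eq))) with sum₁ m m′
      ... | inj₁ hi′ = absurd (1 + 18 * t) (lo ⊕ hi′ ⊕ ≤-reflexive (sym eq)) (solve (t ∷ d ∷ e ∷ e′ ∷ []))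
      ... | inj₂ (inj₁ (_ , hi′)) = absurd (1 + 3 * t) (lo ⊕ hi′ ⊕ ≤-reflexive (sym eq)) (solve (t ∷ d ∷ e ∷ e′ ∷ []))
      ... | inj₂ (inj₂ lo′) = absurd 0 (hi ⊕ lo′ ⊕ ≤-reflexive eq) (solve (t ∷ d ∷ e ∷ e′ ∷ []))
      forb : Forbids (suc (6 * t)) (6 * t + 6 * t)
      forb = forbids {u = suc (6 * t)} {6 * t + 6 * t} diam (by (6 * t) (z≤n {0}) (solve (t ∷ []))) no-steps

    -- The second distance set

    module Second (1≤t : 1 ≤ t) (diam : Diam2 (Mirrored (1 + 18 * t) (M₂ t))) where

      no-steps : ∀ {d} → 2 * t ≤ d → d ≤ 2 * t + t → ∀ i → ¬ TwoStep (Mirrored (1 + 18 * t) (M₂ t)) i d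
      no-steps {d} lo hi i (inj₁ eq) =
        absurd 1 (lo ⊕ ≤-reflexive eq ⊕ 1≤t ⊕ 1≤t) (solve (t ∷ d ∷ []))
      no-steps {d} lo hi i (inj₂ (inj₁ m)) = absurd 0 (hi ⊕ lower₂ m) (solve (t ∷ d ∷ []))
      no-steps {d} lo hi i (inj₂ (inj₂ (e , e′ , m , m′ , _ , inj₁ eq))) with sum₂ m m′
      ... | inj₁ (lo′ , _) = absurd (3 * t) (hi ⊕ lo′ ⊕ ≤-reflexive eq) (solve (t ∷ d ∷ e ∷ e′ ∷ []))
      ... | inj₂ lo′       = absurd (1 + 18 * t) (hi ⊕ lo′ ⊕ ≤-reflexive eq) (solve (t ∷ d ∷ e ∷ e′ ∷ []))
      no-steps {d} lo hi i (inj₂ (inj₂ (e , e′ , m , m′ , _ , inj₂ eq))) with sum₂ m m′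
      ... | inj₁ (_ , hi′) = absurd 0 (lo ⊕ hi′ ⊕ ≤-reflexive (sym eq)) (solve (t ∷ d ∷ e ∷ e′ ∷ []))
      ... | inj₂ lo′       = absurd 0 (hi ⊕ lo′ ⊕ ≤-reflexive eq) (solve (t ∷ d ∷ e ∷ e′ ∷ []))
      forb : Forbids (2 * t) (2 * t + t)
      forb = forbids {u = 2 * t} {2 * t + t} diam (by (15 * t) (z≤n {0}) (solve (t ∷ []))) no-steps
      open Fronts (2 * t) t forb

      W : ℕ
      W = suc (2 * t) + (2 * t + t)
      fits : 1 + 18 * t ≤
        3 * t + ((suc (2 * t) + (2 * t + t)) + ((suc (2 * t) + (2 * t + t)) + (suc (2 * t) + (2 * t + t))))
      fits = by 2 (z≤n {0}) (solve (t ∷ []))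

      3t+_ : ∀ z → 3 * t + z ≡ z + (2 * t + t)
      3t+ z = solve (t ∷ z ∷ [])

      window≤ : ∀ x → count χ x W ≤ suc (2 * t)
      -- With `a = 2 * t` and `g = t`, `window` asks for the forbidden differences in [2t + 1, 3t].
      window≤ x = window (2 * t) t 1≤t
        (λ i j lo hi → forb i j (by 1 lo (solve (t ∷ i ∷ j ∷ []))) hi) x W ≤-refl

      module Large (size> : 4 + 6 * t ≤ size#) where

        open ≤-Reasoning

        -- Three windows of length W cover everything outside [ x , x + 3 t ).
        next : ∀ x → ∃[ y ] x ≤ y × y < x + 3 * t × 0 < χ y × Empty x y
        next x with first χ x (3 * t)
        ... | inj₁ found = found
        ... | inj₂ e = absurd 0 (≤-trans size> (begin
          size#
            ≡⟨ count-period x ⟨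
          count χ x (1 + 18 * t)
            ≤⟨ count-monoʳ χ x {1 + 18 * t} {3 * t + (W + (W + W))} fits ⟩
          count χ x (3 * t + (W + (W + W)))
            ≡⟨ count-++ χ x (3 * t) (W + (W + W)) ⟩
          count χ x (3 * t) + count χ (x + 3 * t) (W + (W + W))
            ≡⟨ cong₂ _+_ (count-empty χ x (3 * t) e)
                 (trans (count-++ χ (x + 3 * t) W (W + W))
                   (cong (count χ (x + 3 * t) W +_) (count-++ χ (x + 3 * t + W) W W))) ⟩
          count χ (x + 3 * t) W + (count χ (x + 3 * t + W) W + count χ (x + 3 * t + W + W) W)
            ≤⟨ window≤ (x + 3 * t) ⊕ (window≤ (x + 3 * t + W) ⊕ window≤ (x + 3 * t + W + W)) ⟩
          suc (2 * t) + (suc (2 * t) + suc (2 * t)) ∎)) (solve (t ∷ []))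

        abstract
          3t≤y : ∀ z y → z + (2 * t + t) + (2 * t + t) < y → 3 * t ≤ y
          3t≤y z y y> = by (1 + z + 3 * t) y> (solve (t ∷ z ∷ y ∷ []))
          3t≤y′ : ∀ z b y′ → b + t < y′ → z + (2 * t + t) + (2 * t + t) < 3 * t + b → 3 * t ≤ y′
          3t≤y′ z b y′ y′> y> = by (2 + z + t) (y′> ⊕ y>) (solve (t ∷ z ∷ b ∷ y′ ∷ []))

        -- Let a = z + 3t.  With y the first element ≥ a + 2t, the first element ≥ y − 3t is preceded
        -- by a gap longer than t and lies below a + 2t.
        advance : ∀ z → 0 < χ (z + (2 * t + t)) → ∃[ z′ ] Front z′ × z < z′ × z′ ≤ z + 2 * t
        advance z 0<χa with y , lo , hi , 0<χy , e ← next (z + (2 * t + t) + 2 * t)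
          with z + (2 * t + t) + (2 * t + t) <? y
        ... | no  y≯ = χ-absurd 0<χy (forb (z + (2 * t + t)) y lo (≮⇒≥ y≯) 0<χa)
        ... | yes y>
          with b , refl ← m≤n⇒∃[o]m+o≡n {3 * t} {y} (3t≤y z y y>)
          with y′ , lo′ , hi′ , 0<χy′ , e′ ← next b
          -- `y′` cannot lie in [a + 2t, y) by the choice of `y`, and `y′ ≤ b + t` would put the
          -- difference of `y` and `y′` into [2t, 3t].
          with y′ <? z + (2 * t + t) + 2 * t | b + t <? y′
        ... | no  y′≮ | _ = χ-absurd 0<χy′ (e y′ (≮⇒≥ y′≮) (subst (y′ <_) (+-comm b (3 * t)) hi′))
        ... | yes _ | no  y′≯ = χ-absurd 0<χy (forb y′ (3 * t + b)
                (by 0 (≮⇒≥ y′≯) (solve (t ∷ b ∷ y′ ∷ [])))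
                (by 0 lo′ (solve (t ∷ b ∷ y′ ∷ []))) 0<χy′)
        ... | yes y′< | yes y′>
          with z′ , refl ← m≤n⇒∃[o]m+o≡n {3 * t} {y′} (3t≤y′ z b y′ y′> y>)
          = z′
          , ( subst (λ i → 0 < χ i) (3t+ z′) 0<χy′
            , λ i i≥ i< → e′ i (by 1 (y′> ⊕ i≥) (solve (t ∷ b ∷ z′ ∷ i ∷ [])))
                               (by 0 i< (solve (t ∷ z′ ∷ i ∷ []))))
          , by (1 + t) (y′> ⊕ y>) (solve (t ∷ z ∷ b ∷ z′ ∷ []))
          , by 1 y′< (solve (t ∷ z ∷ z′ ∷ []))

        -- The search starts at 3t so that the element found has the form `c + 3 * t` that `advance`
        -- expects.
        front₀ : ∃[ x ] Front x
        front₀ with y , lo , _ , 0<χy , _ ← next (3 * t)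
          with c , refl ← m≤n⇒∃[o]m+o≡n lo
          with x , front , _ ← advance c (subst (λ i → 0 < χ i) (3t+ c) 0<χy) = x , front

        -- Abstract, since with-abstraction over chain 6 would otherwise unfold it completely.
        abstract
          chain : ∀ k → ∃[ x ] ∃[ z ] Saves k x z × Front z × z ≤ x + k * (2 * t)
          chain zero with x , front ← front₀ = x , x , saves-none x , front , m≤m+n x 0
          chain (suc k) with x , z , saves , front@(0<χ , _) , z≤ ← chain k
            with z′ , front′ , z<z′ , z′≤ ← advance z 0<χ =
            x , z′ , saves-front {k} saves front (front-sep front front′ z<z′) , front′ ,
            ≤-trans z′≤ (≤-trans (+-monoˡ-≤ (2 * t) z≤) (≤-reflexive (lemma x (2 * t) (k * (2 * t)))))
            where
            lemma : ∀ x a b → x + b + a ≡ x + (a + b)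
            lemma x a b = solve (x ∷ a ∷ b ∷ [])

        contradiction : ⊥
        -- Six moves of at most 2t stay within one period and save 6t, but 2 (6t + 4) + 6t exceeds n
        -- by 7.
        contradiction with x , z , saves , _ , z≤ ← chain 6 =
          absurd 6 (saves-bound {6} saves (by (1 + 6 * t) z≤ (solve (t ∷ x ∷ z ∷ []))) ⊕ size> ⊕ size>)
            (lemma t size#)
          where
          lemma : ∀ t s → s + s + 6 * t + (4 + 6 * t) + (4 + 6 * t) ≡ 1 + 18 * t + s + s + 7
          lemma t s = solve (t ∷ s ∷ [])

    bound₂ : 1 ≤ t → Diam2 (Mirrored (1 + 18 * t) (M₂ t)) → size# ≤ 6 * t + 3
    bound₂ 1≤t diam with size# ≤? 6 * t + 3
    ... | yes size≤ = size≤
    ... | no  size≰ = ⊥-elim (Second.Large.contradiction 1≤t diam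
            (≤-trans (≤-reflexive (+-comm 4 (6 * t)))
              (≤-trans (≤-reflexive (+-suc (6 * t) 3)) (≰⇒> size≰))))

    -- The third distance set

    module Third (r : ℕ) (1+r≡t : 1 + r ≡ t) (diam : Diam2 (Mirrored (1 + 18 * t) (M₃ t))) where

      r<t : 1 + r ≤ t
      r<t = ≤-reflexive 1+r≡t

      t≤1+r : t ≤ 1 + r
      t≤1+r = ≤-reflexive (sym 1+r≡t)

      no-steps : ∀ {d} → 1 + 8 * t ≤ d → d ≤ 1 + 8 * t + (1 + (r + r)) →
        ∀ i → ¬ TwoStep (Mirrored (1 + 18 * t) (M₃ t)) i d
      no-steps {d} lo hi i (inj₁ eq) = absurd (8 * t) (lo ⊕ ≤-reflexive eq) (solve (t ∷ d ∷ []))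
      no-steps {d} lo hi i (inj₂ (inj₁ m)) with mirrored₃ m
      ... | inj₁ (_ , hi′) = absurd 0 (lo ⊕ hi′) (solve (t ∷ d ∷ []))
      ... | inj₂ (lo′ , _) = absurd 0 (hi ⊕ lo′ ⊕ r<t ⊕ r<t) (solve (t ∷ r ∷ d ∷ []))
      no-steps {d} lo hi i (inj₂ (inj₂ (e , e′ , m , m′ , _ , inj₁ eq)))
        with lo₁ , _ ← hull₃ m | lo₂ , _ ← hull₃ m′ =
        absurd 1 (hi ⊕ lo₁ ⊕ lo₂ ⊕ ≤-reflexive eq ⊕ r<t ⊕ r<t) (solve (t ∷ r ∷ d ∷ e ∷ e′ ∷ []))
      no-steps {d} lo hi i (inj₂ (inj₂ (e , e′ , m , m′ , _ , inj₂ eq)))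
        with _ , hi₁ ← hull₃ m | _ , hi₂ ← hull₃ m′ =
        absurd 1 (lo ⊕ hi₁ ⊕ hi₂ ⊕ ≤-reflexive (sym eq)) (solve (t ∷ d ∷ e ∷ e′ ∷ []))

      -- The forbidden range is [8t + 1, 10t]. Its length 2t - 1 is written `1 + (r + r)` to avoid
      -- truncated subtraction.
      forb : Forbids (1 + 8 * t) (1 + 8 * t + (1 + (r + r)))
      forb = forbids {u = 1 + 8 * t} {1 + 8 * t + (1 + (r + r))} diam
        (by (8 * t) (r<t ⊕ r<t) (solve (t ∷ r ∷ []))) no-steps

      open Fronts (1 + 8 * t) (1 + (r + r)) forb

      abstract
        in-range : ∀ p d → p + d < p + 3 * t + (1 + 2 * t) → d < 1 + 18 * t
        in-range p d hi = by (13 * t) hi (solve (t ∷ p ∷ d ∷ []))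

      -- An edge within [ p , p + 8 t ] joins two points at distance more than 5 t, so the middle of
      -- this arc contributes nothing.
      arc-middle : ∀ p q → 0 < χ p → Empty (p + (1 + 8 * t)) q → p + (1 + 18 * t) ≤ q →
        Empty (p + 3 * t) (p + 3 * t + (1 + 2 * t))
      arc-middle p q 0<χp e p+n≤q x lo hi with zero? (χ x)
      ... | inj₁ χx≡0 = χx≡0
      ... | inj₂ 0<χx
        with d , refl ← m≤n⇒∃[o]m+o≡n (≤-trans (m≤m+n p (3 * t)) lo)
        with diam p d (in-range p d hi) 0<χp 0<χx
      ...   | inj₁ eq = absurd (2 + 3 * r) (lo ⊕ ≤-reflexive eq ⊕ r<t ⊕ r<t ⊕ r<t) (solve (t ∷ r ∷ p ∷ d ∷ []))
      ...   | inj₂ (inj₁ m) = absurd 0 (hi ⊕ proj₁ (hull₃ m)) (solve (t ∷ p ∷ d ∷ []))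
      ...   | inj₂ (inj₂ (e₁ , e₂ , m₁ , m₂ , _ , inj₁ eq)) =
              absurd (1 + 5 * t) (hi ⊕ proj₁ (hull₃ m₁) ⊕ proj₁ (hull₃ m₂) ⊕ ≤-reflexive eq)
                (solve (t ∷ p ∷ d ∷ e₁ ∷ e₂ ∷ []))
      ...   | inj₂ (inj₂ (e₁ , e₂ , m₁ , m₂ , 0<χz , inj₂ eq))
        -- If e₁ > 8t, the midpoint `p + e₁` falls into the empty stretch before `q`. Otherwise e₁ +
        -- e₂ ≤ 21t, which is less than d + n.
        with _ , hi₁ ← hull₃ m₁ | _ , hi₂ ← hull₃ m₂ | 1 + 8 * t ≤? e₁
      ...     | yes lo₁ = χ-absurd 0<χz (e (p + e₁) (+-monoʳ-≤ p lo₁)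
                (by (5 * t) (hi₁ ⊕ p+n≤q) (solve (t ∷ p ∷ q ∷ e₁ ∷ []))))
      ...     | no  lo₁≰ = absurd 0 (≰⇒> lo₁≰ ⊕ hi₂ ⊕ lo ⊕ ≤-reflexive (sym eq))
                (solve (t ∷ p ∷ d ∷ e₁ ∷ e₂ ∷ []))

      -- Cut the period after `p` into blocks of 3t, 2t + 1, 3t and 10t places. The second is empty
      -- by `arc-middle` and the last by assumption.
      arc-bound : ∀ p q → 0 < χ p → Empty (p + (1 + 8 * t)) q → p + (1 + 18 * t) ≤ q →
        size# ≤ 6 * t + 3
      arc-bound p q 0<χp e p+n≤q = begin
        size#
          ≡⟨ count-period p ⟨
        count χ p (1 + 18 * t)
          ≡⟨ cong (count χ p) split ⟩
        count χ p (3 * t + (1 + 2 * t + (3 * t + 10 * t)))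
          ≡⟨ trans (count-++ χ p (3 * t) _) (cong (count χ p (3 * t) +_)
               (trans (count-++ χ (p + 3 * t) (1 + 2 * t) _) (cong (count χ (p + 3 * t) (1 + 2 * t) +_)
                 (count-++ χ (p + 3 * t + (1 + 2 * t)) (3 * t) (10 * t))))) ⟩
        count χ p (3 * t) + (count χ (p + 3 * t) (1 + 2 * t)
          + (count χ (p + 3 * t + (1 + 2 * t)) (3 * t) + count χ (p + 3 * t + (1 + 2 * t) + 3 * t) (10 * t)))
          ≡⟨ cong₂ (λ a b → count χ p (3 * t) + (a + (count χ (p + 3 * t + (1 + 2 * t)) (3 * t) + b)))
               (count-empty χ (p + 3 * t) (1 + 2 * t) (arc-middle p q 0<χp e p+n≤q))
               (count-empty χ _ (10 * t) λ z lo hi → e z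
                 (by 0 lo (solve (t ∷ p ∷ z ∷ [])))
                 (by 0 (hi ⊕ p+n≤q) (solve (t ∷ p ∷ q ∷ z ∷ [])))) ⟩
        count χ p (3 * t) + (count χ (p + 3 * t + (1 + 2 * t)) (3 * t) + 0)
          ≤⟨ count≤ χ χ≤1 p (3 * t) ⊕ (count≤ χ χ≤1 (p + 3 * t + (1 + 2 * t)) (3 * t) ⊕ z≤n {3}) ⟩
        3 * t + (3 * t + 3)
          ≡⟨ solve (t ∷ []) ⟩
        6 * t + 3 ∎
        where
        open ≤-Reasoning
        split : 1 + 18 * t ≡ 3 * t + (1 + 2 * t + (3 * t + 10 * t))
        split = solve (t ∷ [])

      v : ℕ
      v = 1 + 8 * t + (1 + (r + r))

      v≡10t : 1 + 8 * t + (1 + (r + r)) ≡ 10 * t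
      v≡10t = ≤-antisym (by 0 (r<t ⊕ r<t) (solve (t ∷ r ∷ []))) (by 0 (t≤1+r ⊕ t≤1+r) (solve (t ∷ r ∷ [])))

      -- With `p` an element, `z + v` is the first element from `p + (1 + 8 * t)` on. It lies beyond
      -- `p + v`, as the places up to there are forbidden, so it ends a gap and gives a front.
      Next : ℕ → ℕ → Set
      Next p z = Front z × p < z × z + v ≤ p + (1 + 18 * t) × Empty (p + (1 + 8 * t)) (z + v)

      abstract
        next : ∀ p → 0 < χ p → ∃[ z ] Next p z
        -- These 1 + 10t places end with `p + n` itself, an element by periodicity, so the search
        -- succeeds.
        next p 0<χp with first χ (p + (1 + 8 * t)) (1 + 10 * t)
        ... | inj₂ e = χ-absurd 0<χp (trans (sym (periodic p))
                (e (p + (1 + 18 * t))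
                  (by (10 * t) (z≤n {0}) (solve (t ∷ p ∷ []))) (by 0 (z≤n {0}) (solve (t ∷ p ∷ [])))))
        ... | inj₁ (y , lo , hi , 0<χy , e) with p + v <? y
        ...   | no  y≯ = χ-absurd 0<χy (forb p y lo (≮⇒≥ y≯) 0<χp)
        ...   | yes y>
          with z , refl ← m≤n⇒∃[o]m+o≡n (≤-trans (m≤n+m v (suc p)) y>)
          rewrite +-comm v z =
            z
          , (0<χy , λ i i≥ i< → e i
              (≤-trans (+-monoˡ-≤ (1 + 8 * t) (<⇒≤ (+-cancelʳ-< v p z y>))) i≥) i<)
          , +-cancelʳ-< v p z y>
          , ≤-pred (≤-trans hi (≤-reflexive (solve (t ∷ p ∷ []))))
          , e

      -- Three jumps by `next` give fronts with z₁ < z₀ + n < z₂ < z₁ + n, hence three in one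
      -- period. This fails only if a jump returns exactly to its start modulo n; then the set lies
      -- in an arc and `arc-bound` applies.
      bound : size# ≤ 6 * t + 3
      bound with first χ 0 (1 + 18 * t)
      ... | inj₂ e rewrite count-empty χ 0 (1 + 18 * t) e = z≤n
      ... | inj₁ (p , _ , _ , 0<χp , _)
        with z₀ , f₀ , _ ← next p 0<χp
        with z₁ , f₁ , y₀<z₁ , z₁≤ , e₁ ← next (z₀ + v) (proj₁ f₀)
        with m≤n⇒m<n∨m≡n z₁≤
      ...   | inj₂ eq = arc-bound (z₀ + v) (z₁ + v) (proj₁ f₀) e₁ (≤-reflexive (sym eq))
      ...   | inj₁ z₁<
        with z₂ , f₂ , y₁<z₂ , z₂≤ , e₂ ← next (z₁ + v) (proj₁ f₁)
        with m≤n⇒m<n∨m≡n z₂≤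
      ...     | inj₂ eq = arc-bound (z₁ + v) (z₂ + v) (proj₁ f₁) e₂ (≤-reflexive (sym eq))
      -- Three savings of 2t - 1 suffice: 2 (6t + 4) + 3 (2t - 1) exceeds n by 4.
      ...     | inj₁ z₂< = ≮⇒≥ λ size> →
                absurd 3 (saves-bound {3} three ≤-refl ⊕ size> ⊕ size> ⊕ 6t≤6+6r)
                  (lemma t r size#)
        where
        before : ∀ {z z′} → z + v < z′ + v + (1 + 18 * t) → z < z′ + (1 + 18 * t)
        before {z} {z′} h = +-cancelʳ-< v z (z′ + (1 + 18 * t)) (≤-trans h (≤-reflexive (swap z′ v (1 + 18 * t))))
          where
          swap : ∀ a b c → a + b + c ≡ a + c + b
          swap a b c = solve (a ∷ b ∷ c ∷ [])
        far : ∀ a b c w → 10 * t ≤ w → a + w < b → b + w < c → a + (1 + 18 * t) < c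
        far a b c w 10t≤w a+w<b b+w<c =
          by (2 * t) (10t≤w ⊕ 10t≤w ⊕ a+w<b ⊕ b+w<c) (solve (t ∷ a ∷ b ∷ c ∷ w ∷ []))
        z₀+n<z₂ : z₀ + (1 + 18 * t) < z₂
        -- Two jumps of more than 10t each pass a full period.
        z₀+n<z₂ = far z₀ z₁ z₂ v (≤-reflexive (sym v≡10t)) y₀<z₁ y₁<z₂
        6t≤6+6r : 6 * t ≤ 6 * (1 + r)
        6t≤6+6r = *-monoʳ-≤ 6 t≤1+r
        three : Saves 3 z₁ (z₁ + (1 + 18 * t))
        three =
          saves-front {2} (saves-front {1} (saves-front {0} (saves-none z₁) f₁
            (front-sep f₁ (front-period f₀) (before z₁<)))
            (front-period f₀) (front-sep (front-period f₀) f₂ z₀+n<z₂))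
            f₂ (front-sep f₂ (front-period f₁) (before z₂<))
        lemma : ∀ t r s → s + s + 3 * (1 + (r + r)) + suc (6 * t + 3) + suc (6 * t + 3) + 6 * t
              ≡ 1 + 18 * t + s + s + 6 * (1 + r) + 4
        lemma t r s = solve (t ∷ r ∷ s ∷ [])

    bound₃ : 1 ≤ t → Diam2 (Mirrored (1 + 18 * t) (M₃ t)) → size# ≤ 6 * t + 3
    bound₃ 1≤t diam with r , 1+r≡t ← m≤n⇒∃[o]m+o≡n 1≤t = Third.bound r 1+r≡t diam

-- Vertex lists as periodic indicator functions

δ : ℕ → ℕ → ℕ
δ a b with a ≟ b
... | yes _ = 1
... | no  _ = 0

δ-yes : ∀ {a b} → a ≡ b → δ a b ≡ 1
δ-yes {a} {b} a≡b with a ≟ b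
... | yes _   = refl
... | no  a≢b = ⊥-elim (a≢b a≡b)

δ-no : ∀ {a b} → a ≢ b → δ a b ≡ 0
δ-no {a} {b} a≢b with a ≟ b
... | yes a≡b = ⊥-elim (a≢b a≡b)
... | no  _   = refl

module _ {n : ℕ} .{{_ : NonZero n}} where

  %-+ˡ : ∀ a b → (a % n + b) % n ≡ (a + b) % n
  %-+ˡ a b = begin
    (a % n + b) % n          ≡⟨ %-distribˡ-+ (a % n) b n ⟩
    (a % n % n + b % n) % n  ≡⟨ cong (λ m → (m + b % n) % n) (m%n%n≡m%n a n) ⟩
    (a % n + b % n) % n      ≡⟨ %-distribˡ-+ a b n ⟨
    (a + b) % n              ∎
    where open ≡-Reasoning

  -- Adding `n ∸ x` undoes the addition of `x` modulo n.
  %-cancelˡ : ∀ {x} d d′ → x ≤ n → (x + d) % n ≡ (x + d′) % n → d % n ≡ d′ % n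
  %-cancelˡ {x} d d′ x≤n eq = begin
    d % n                         ≡⟨ complement d ⟨
    ((x + d) % n + (n ∸ x)) % n   ≡⟨ cong (λ m → (m + (n ∸ x)) % n) eq ⟩
    ((x + d′) % n + (n ∸ x)) % n  ≡⟨ complement d′ ⟩
    d′ % n                        ∎
    where
    open ≡-Reasoning
    complement : ∀ d → ((x + d) % n + (n ∸ x)) % n ≡ d % n
    complement d = begin
      ((x + d) % n + (n ∸ x)) % n  ≡⟨ %-+ˡ (x + d) (n ∸ x) ⟩
      (x + d + (n ∸ x)) % n        ≡⟨ cong (_% n) (rearrange x d (n ∸ x)) ⟩
      (d + (x + (n ∸ x))) % n      ≡⟨ cong (λ m → (d + m) % n) (m+[n∸m]≡n x≤n) ⟩
      (d + n) % n                  ≡⟨ [m+n]%n≡m%n d n ⟩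
      d % n                        ∎
      where
      rearrange : ∀ x d c → x + d + c ≡ d + (x + c)
      rearrange x d c = solve (x ∷ d ∷ c ∷ [])

  %-lift : ∀ {d d′} → d < n → d′ < n + n → d % n ≡ d′ % n → d′ ≡ d ⊎ d′ ≡ d + n
  %-lift {d} {d′} d<n d′<2n eq with d′ <? n
  ... | yes d′<n = inj₁ (trans (sym (m<n⇒m%n≡m d′<n)) (trans (sym eq) (m<n⇒m%n≡m d<n)))
  ... | no  d′≮n with k , refl ← m≤n⇒∃[o]m+o≡n (≮⇒≥ d′≮n) =
    inj₂ (trans (+-comm n k) (cong (_+ n) (begin
      k            ≡⟨ m<n⇒m%n≡m (+-cancelˡ-< n k n d′<2n) ⟨
      k % n        ≡⟨ [m+n]%n≡m%n k n ⟨
      (k + n) % n  ≡⟨ cong (_% n) (+-comm k n) ⟩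
      (n + k) % n  ≡⟨ eq ⟨
      d % n        ≡⟨ m<n⇒m%n≡m d<n ⟩
      d            ∎)))
    where open ≡-Reasoning

  -- For a list without repetitions this is the indicator `χ` of its vertices, extended periodically
  -- to `ℕ`.
  occurrences : List (Fin n) → ℕ → ℕ
  occurrences []       i = 0
  occurrences (x ∷ xs) i = δ (toℕ x) (i % n) + occurrences xs i

  occurs⇒∈ : ∀ xs {i} → 0 < occurrences xs i → ∃[ x ] x ∈ xs × toℕ x ≡ i % n
  occurs⇒∈ (x ∷ xs) {i} 0< with toℕ x ≟ i % n
  ... | yes x≡i = x , here refl , x≡i
  ... | no  _ with y , y∈xs , y≡i ← occurs⇒∈ xs 0< = y , there y∈xs , y≡i

  ∈⇒occurs : ∀ {xs x i} → x ∈ xs → toℕ x ≡ i % n → 0 < occurrences xs i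
  ∈⇒occurs {i = i} (here refl)  x≡i rewrite δ-yes x≡i = z<s
  ∈⇒occurs         (there x∈xs) x≡i = ≤-trans (∈⇒occurs x∈xs x≡i) (m≤n+m _ _)

  occurrences≤1 : ∀ {xs} → Unique xs → ∀ i → occurrences xs i ≤ 1
  occurrences≤1 {[]}     []       i = z≤n
  occurrences≤1 {x ∷ xs} (x∉ ∷ u) i with toℕ x ≟ i % n
  ... | no  _   = occurrences≤1 u i
  ... | yes x≡i with zero? (occurrences xs i)
  ...   | inj₁ ≡0 rewrite ≡0 = ≤-refl
  ...   | inj₂ 0< with y , y∈xs , y≡i ← occurs⇒∈ xs 0< =
            ⊥-elim (All.lookup x∉ y∈xs (toℕ-injective (trans x≡i (sym y≡i))))

  occurrences-periodic : ∀ xs i → occurrences xs (i + n) ≡ occurrences xs i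
  occurrences-periodic []       i = refl
  occurrences-periodic (x ∷ xs) i =
    cong₂ _+_ (cong (δ (toℕ x)) ([m+n]%n≡m%n i n)) (occurrences-periodic xs i)

  count-δ : ∀ {a} → a < n → count (λ i → δ a (i % n)) 0 n ≡ 1
  count-δ {a} a<n with r , eq ← m≤n⇒∃[o]m+o≡n a<n = begin
    count f 0 n
      ≡⟨ cong (count f 0) (trans (sym eq) (sym (+-suc a r))) ⟩
    count f 0 (a + suc r)
      ≡⟨ count-++ f 0 a (suc r) ⟩
    count f 0 a + (f a + count f (suc a) r)
      ≡⟨ cong₂ (λ l m → l + (f a + m))
           (count-empty f 0 a λ z _ z<a → misses (<⇒≢ z<a) (<-trans z<a a<n))
           (count-empty f (suc a) r λ z a<z z< → misses (≢-sym (<⇒≢ a<z)) (subst (z <_) eq z<)) ⟩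
    f a + 0
      ≡⟨ trans (+-identityʳ _) (δ-yes (sym (m<n⇒m%n≡m a<n))) ⟩
    1 ∎
    where
    open ≡-Reasoning
    f : ℕ → ℕ
    f i = δ a (i % n)
    misses : ∀ {z} → z ≢ a → z < n → f z ≡ 0
    misses z≢a z<n = δ-no λ a≡ → z≢a (sym (trans a≡ (m<n⇒m%n≡m z<n)))

  count-occurrences : ∀ xs → count (occurrences xs) 0 n ≡ length xs
  count-occurrences []       = count-empty (λ _ → 0) 0 n (λ _ _ _ → refl)
  count-occurrences (x ∷ xs) = begin
    count (occurrences (x ∷ xs)) 0 n
      ≡⟨ count-+ (λ i → δ (toℕ x) (i % n)) (occurrences xs) 0 n ⟩
    count (λ i → δ (toℕ x) (i % n)) 0 n + count (occurrences xs) 0 n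
      ≡⟨ cong₂ _+_ (count-δ (toℕ<n x)) (count-occurrences xs) ⟩
    suc (length xs) ∎
    where open ≡-Reasoning

  -- Forward steps modulo n and the edges of circle graphs

  Step : ℕ → Fin n → Fin n → Set
  Step e x y = (toℕ x + e) % n ≡ toℕ y

  step-trans : ∀ {e e′ x y z} → Step e x z → Step e′ z y → Step (e + e′) x y
  step-trans {e} {e′} {x} {y} {z} x→z z→y = begin
    (toℕ x + (e + e′)) % n      ≡⟨ cong (_% n) (+-assoc (toℕ x) e e′) ⟨
    (toℕ x + e + e′) % n        ≡⟨ %-+ˡ (toℕ x + e) e′ ⟨
    ((toℕ x + e) % n + e′) % n  ≡⟨ cong (λ m → (m + e′) % n) x→z ⟩
    (toℕ z + e′) % n            ≡⟨ z→y ⟩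
    toℕ y                       ∎
    where open ≡-Reasoning

  step-% : ∀ {i e x z} → toℕ x ≡ i % n → Step e x z → toℕ z ≡ (i + e) % n
  step-% {i} {e} {x} {z} x≡ x→z = begin
    toℕ z            ≡⟨ x→z ⟨
    (toℕ x + e) % n  ≡⟨ cong (λ m → (m + e) % n) x≡ ⟩
    (i % n + e) % n  ≡⟨ %-+ˡ i e ⟩
    (i + e) % n      ∎
    where open ≡-Reasoning

  -- The length of a path of at most two steps is below 2n, and only two such numbers are congruent
  -- to `d`.
  step-lift : ∀ {i d e x y} → toℕ x ≡ i % n → toℕ y ≡ (i + d) % n → d < n → e < n + n →
    Step e x y → e ≡ d ⊎ e ≡ d + n
  step-lift {i} {d} {e} {x} {y} x≡ y≡ d<n e<2n x→y =
    %-lift d<n e<2n (%-cancelˡ {i % n} d e (<⇒≤ (m%n<n i n)) (begin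
      (i % n + d) % n  ≡⟨ %-+ˡ i d ⟩
      (i + d) % n      ≡⟨ y≡ ⟨
      toℕ y            ≡⟨ step-% {i} {e} {x} {y} x≡ x→y ⟩
      (i + e) % n      ≡⟨ %-+ˡ i e ⟨
      (i % n + e) % n  ∎))
    where open ≡-Reasoning

  toℕ-% : ∀ (x : Fin n) → toℕ x % n ≡ toℕ x
  toℕ-% x = m<n⇒m%n≡m (toℕ<n x)

  step-diffMod : ∀ x y → Step (diffMod n y x) x y
  step-diffMod x y = begin
    (toℕ x + (toℕ y + n ∸ toℕ x) % n) % n  ≡⟨ cong (_% n) (+-comm (toℕ x) _) ⟩
    ((toℕ y + n ∸ toℕ x) % n + toℕ x) % n  ≡⟨ %-+ˡ (toℕ y + n ∸ toℕ x) (toℕ x) ⟩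
    (toℕ y + n ∸ toℕ x + toℕ x) % n        ≡⟨ cong (_% n) (m∸n+n≡m (≤-trans (<⇒≤ (toℕ<n x)) (m≤n+m n (toℕ y)))) ⟩
    (toℕ y + n) % n                        ≡⟨ [m+n]%n≡m%n (toℕ y) n ⟩
    toℕ y % n                              ≡⟨ toℕ-% y ⟩
    toℕ y                                  ∎
    where open ≡-Reasoning

  step-reverse : ∀ {e e′ x y} → Step e y x → e′ + e ≡ n → Step e′ x y
  step-reverse {e} {e′} {x} {y} y→x eq = begin
    (toℕ x + e′) % n            ≡⟨ cong (λ m → (m + e′) % n) y→x ⟨
    ((toℕ y + e) % n + e′) % n  ≡⟨ %-+ˡ (toℕ y + e) e′ ⟩
    (toℕ y + e + e′) % n        ≡⟨ cong (_% n) (trans (+-assoc (toℕ y) e e′)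
                                                 (cong (toℕ y +_) (trans (+-comm e e′) eq))) ⟩
    (toℕ y + n) % n             ≡⟨ [m+n]%n≡m%n (toℕ y) n ⟩
    toℕ y % n                   ≡⟨ toℕ-% y ⟩
    toℕ y                       ∎
    where open ≡-Reasoning

  diffMod<n : ∀ x y → diffMod n x y < n
  diffMod<n x y = m%n<n (toℕ x + n ∸ toℕ y) n

  diffMod-self : ∀ x → diffMod n x x ≡ 0
  diffMod-self x = trans (cong (_% n) (m+n∸m≡n (toℕ x) n)) (n%n≡0 n)

  -- For y = x + suc k the two differences are n - suc k and suc k.
  diffMod-sum-< : ∀ x y → toℕ x < toℕ y → diffMod n x y + diffMod n y x ≡ n
  diffMod-sum-< x y x<y with k , eq ← m≤n⇒∃[o]m+o≡n x<y = begin
    diffMod n x y + diffMod n y x  ≡⟨ cong₂ _+_ forward backward ⟩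
    n ∸ suc k + suc k              ≡⟨ m∸n+n≡m (<⇒≤ k<n) ⟩
    n                              ∎
    where
    open ≡-Reasoning
    y≡ : toℕ y ≡ toℕ x + suc k
    y≡ = trans (sym eq) (sym (+-suc (toℕ x) k))
    k<n : suc k < n
    k<n = ≤-<-trans (≤-trans (m≤n+m (suc k) (toℕ x)) (≤-reflexive (sym y≡))) (toℕ<n y)
    forward : diffMod n x y ≡ n ∸ suc k
    forward = begin
      (toℕ x + n ∸ toℕ y) % n            ≡⟨ cong (λ m → (toℕ x + n ∸ m) % n) y≡ ⟩
      (toℕ x + n ∸ (toℕ x + suc k)) % n  ≡⟨ cong (_% n) ([m+n]∸[m+o]≡n∸o (toℕ x) n (suc k)) ⟩
      (n ∸ suc k) % n                    ≡⟨ m<n⇒m%n≡m (∸-monoʳ-< z<s (<⇒≤ k<n)) ⟩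
      n ∸ suc k                          ∎
    backward : diffMod n y x ≡ suc k
    backward = begin
      (toℕ y + n ∸ toℕ x) % n            ≡⟨ cong (λ m → (m + n ∸ toℕ x) % n) y≡ ⟩
      (toℕ x + suc k + n ∸ toℕ x) % n    ≡⟨ cong (λ m → (m ∸ toℕ x) % n) (+-assoc (toℕ x) (suc k) n) ⟩
      (toℕ x + (suc k + n) ∸ toℕ x) % n  ≡⟨ cong (_% n) (m+n∸m≡n (toℕ x) (suc k + n)) ⟩
      (suc k + n) % n                    ≡⟨ [m+n]%n≡m%n (suc k) n ⟩
      suc k % n                          ≡⟨ m<n⇒m%n≡m k<n ⟩
      suc k                              ∎

  diffMod-sum : ∀ {x y} → x ≢ y → diffMod n x y + diffMod n y x ≡ n
  diffMod-sum {x} {y} x≢y with <-cmp (toℕ x) (toℕ y)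
  ... | tri< x<y _ _ = diffMod-sum-< x y x<y
  ... | tri≈ _ x≡y _ = ⊥-elim (x≢y (toℕ-injective x≡y))
  ... | tri> _ _ y<x = trans (+-comm (diffMod n x y) _) (diffMod-sum-< y x y<x)

  -- If the difference in `S` is that of y to x, it is the step itself; otherwise the step is its
  -- reversal, whose length n - d is below n because d is positive.
  circle-step : ∀ {S x y} → (∀ {d} → d ∈ S → 0 < d) → Circle n S x y →
    ∃[ e ] e < n × Mirrored n (_∈ S) e × Step e x y
  circle-step {S} {x} {y} pos (inj₂ d∈S) = diffMod n y x , diffMod<n y x , inj₁ d∈S , step-diffMod x y
  circle-step {S} {x} {y} pos (inj₁ d∈S) =
      n ∸ diffMod n x y
    , ∸-monoʳ-< (pos d∈S) d≤n
    , inj₂ (diffMod n x y , d∈S , m∸n+n≡m d≤n)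
    , step-reverse {e = diffMod n x y} (step-diffMod y x) (m∸n+n≡m d≤n)
    where
    d≤n : diffMod n x y ≤ n
    d≤n = <⇒≤ (diffMod<n x y)

-- From diameter two subgraphs to cyclic sets

Mirrored-map : ∀ {n M N} → (∀ {d} → M d → N d) → ∀ {e} → Mirrored n M e → Mirrored n N e
Mirrored-map f (inj₁ m)             = inj₁ (f m)
Mirrored-map f (inj₂ (e′ , m , eq)) = inj₂ (e′ , f m , eq)

module _ (t : ℕ) {S : List ℕ} {M : ℕ → Set}
         (pos : ∀ {d} → d ∈ S → 0 < d) (sound : ∀ {d} → d ∈ S → M d) where

  open Subgraph

  -- Equality, an edge or a path of two edges in `H` becomes a forward step of length 0, of one
  -- length or of a sum of two, and `step-lift` compares it with `d`.
  diam2 : (H : Subgraph (Circle (1 + 18 * t) S)) → DiameterTwo H →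
    (χ≤1 : ∀ i → occurrences (verts H) i ≤ 1)
    (periodic : ∀ i → occurrences (verts H) (i + (1 + 18 * t)) ≡ occurrences (verts H) i) →
    Diam2 t (occurrences (verts H)) χ≤1 periodic (Mirrored (1 + 18 * t) M)
  diam2 H diam χ≤1 periodic i d d<n 0<χi 0<χj
    with occurs⇒∈ (verts H) 0<χi | occurs⇒∈ (verts H) 0<χj
  ... | x , x∈H , x≡ | y , y∈H , y≡
    with diam x y x∈H y∈H
  ...   | inj₁ refl with step-lift {i = i} {d} {0} {x} {x} x≡ y≡ d<n z<s
                         (trans (cong (_% (1 + 18 * t)) (+-identityʳ (toℕ x))) (toℕ-% x))
  ...   | inj₁ 0≡d   = inj₁ (sym 0≡d)
  ...   | inj₂ 0≡d+n = ⊥-elim (m+1+n≢0 d (sym 0≡d+n))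
  diam2 H diam χ≤1 periodic i d d<n 0<χi 0<χj
      | x , x∈H , x≡ | y , y∈H , y≡ | inj₂ (inj₁ x—y)
    with _ , _ , c ← edge-in H x y x—y
    with e , e<n , m , step ← circle-step pos c
    with step-lift {i = i} {d} {e} {x} {y} x≡ y≡ d<n (<-trans e<n (m<m+n _ z<s)) step
  ...   | inj₁ refl = inj₂ (inj₁ (Mirrored-map sound m))
  ...   | inj₂ refl = ⊥-elim (m+n≮n d (1 + 18 * t) e<n)
  diam2 H diam χ≤1 periodic i d d<n 0<χi 0<χj
      | x , x∈H , x≡ | y , y∈H , y≡ | inj₂ (inj₂ (z , z∈H , x—z , z—y))
    with _ , _ , c ← edge-in H x z x—z | _ , _ , c′ ← edge-in H z y z—y
    with e , e<n , m , step ← circle-step pos c | e′ , e′<n , m′ , step′ ← circle-step pos c′ =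
      inj₂ (inj₂ (e , e′ , Mirrored-map sound m , Mirrored-map sound m′
        , ∈⇒occurs z∈H (step-% {i = i} {e} {x} {z} x≡ step)
        , step-lift {i = i} {d} {e + e′} {x} {y} x≡ y≡ d<n (+-mono-< e<n e′<n)
            (step-trans {e = e} {e′} {x} {y} {z} step step′)))

  circle-bound : ∀ {m} →
    (∀ χ χ≤1 periodic → Diam2 t χ χ≤1 periodic (Mirrored (1 + 18 * t) M) → count χ 0 (1 + 18 * t) ≤ m) →
    MaxDiam2AtMost (Circle (1 + 18 * t) S) m
  circle-bound {m} bound H diam = subst (_≤ m) (count-occurrences (verts H))
    (bound _ χ≤1 periodic (diam2 H diam χ≤1 periodic))
    where
    χ≤1 = occurrences≤1 (uniq H)
    periodic = occurrences-periodic (verts H)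

-- The connection sets and the partition of the edges

interval : ℕ → ℕ → List ℕ
interval a b = applyUpTo (a +_) (suc b ∸ a)

∈-interval⁺ : ∀ {a b d} → Within a b d → d ∈ interval a b
∈-interval⁺ {a} {b} (a≤d , d≤b) with k , refl ← m≤n⇒∃[o]m+o≡n a≤d =
  ∈-applyUpTo⁺ (a +_) (m+n≤o⇒m≤o∸n (suc k) (s≤s (≤-trans (≤-reflexive (+-comm k a)) d≤b)))

∈-interval⁻ : ∀ {a b d} → d ∈ interval a b → Within a b d
∈-interval⁻ {a} {b} d∈ with k , k< , refl ← ∈-applyUpTo⁻ (a +_) d∈ = m≤m+n a k , a+k≤b
  where
  a+k≤b : a + k ≤ b
  a+k≤b with suc b ≤? a
  ... | yes b<a = ⊥-elim (n≮0 (subst (k <_) (m≤n⇒m∸n≡0 b<a) k<))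
  ... | no  b≮a = ≤-pred (≤-trans (+-monoʳ-< a k<) (≤-reflexive (m+[n∸m]≡n (<⇒≤ (≰⇒> b≮a)))))

module _ (t : ℕ) where

  S₁ S₂ S₃ : List ℕ
  S₁ = interval 1 (3 * t)
  S₂ = interval (1 + 3 * t) (5 * t) ++ interval (1 + 8 * t) (9 * t)
  S₃ = interval (1 + 5 * t) (8 * t)

  sound₁ : ∀ {d} → d ∈ S₁ → M₁ t d
  sound₁ = ∈-interval⁻

  sound₂ : ∀ {d} → d ∈ S₂ → M₂ t d
  sound₂ d∈ = Sum.map ∈-interval⁻ ∈-interval⁻ (∈-++⁻ (interval (1 + 3 * t) (5 * t)) d∈)

  sound₃ : ∀ {d} → d ∈ S₃ → M₃ t d
  sound₃ = ∈-interval⁻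

  Small : ℕ → Set
  Small = Within 1 (9 * t)

  small₁ : ∀ {d} → d ∈ S₁ → Small d
  small₁ {d} d∈ with lo , hi ← sound₁ d∈ = lo , by (6 * t) hi (solve (t ∷ d ∷ []))

  small₂ : ∀ {d} → d ∈ S₂ → Small d
  small₂ {d} d∈ with sound₂ d∈
  ... | inj₁ (lo , hi) = ≤-trans (s≤s z≤n) lo , by (4 * t) hi (solve (t ∷ d ∷ []))
  ... | inj₂ (lo , hi) = ≤-trans (s≤s z≤n) lo , hi

  small₃ : ∀ {d} → d ∈ S₃ → Small d
  small₃ {d} d∈ with lo , hi ← sound₃ d∈ = ≤-trans (s≤s z≤n) lo , by t hi (solve (t ∷ d ∷ []))

  cover : ∀ {d} → Small d → d ∈ S₁ ⊎ d ∈ S₂ ⊎ d ∈ S₃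
  cover {d} (lo , hi) with d ≤? 3 * t | d ≤? 5 * t | d ≤? 8 * t
  ... | yes d≤3t | _        | _        = inj₁ (∈-interval⁺ (lo , d≤3t))
  ... | no  d≰3t | yes d≤5t | _        = inj₂ (inj₁ (∈-++⁺ˡ (∈-interval⁺ (≰⇒> d≰3t , d≤5t))))
  ... | no  _    | no  d≰5t | yes d≤8t = inj₂ (inj₂ (∈-interval⁺ (≰⇒> d≰5t , d≤8t)))
  ... | no  _    | no  _    | no  d≰8t =
    inj₂ (inj₁ (∈-++⁺ʳ (interval (1 + 3 * t) (5 * t)) (∈-interval⁺ (≰⇒> d≰8t , hi))))

  disjoint₁₂ : ∀ {d} → d ∈ S₁ → d ∈ S₂ → ⊥
  disjoint₁₂ {d} d∈₁ d∈₂ with _ , hi ← sound₁ d∈₁ | sound₂ d∈₂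
  ... | inj₁ (lo , _) = absurd 0 (hi ⊕ lo) (solve (t ∷ d ∷ []))
  ... | inj₂ (lo , _) = absurd (5 * t) (hi ⊕ lo) (solve (t ∷ d ∷ []))

  disjoint₁₃ : ∀ {d} → d ∈ S₁ → d ∈ S₃ → ⊥
  disjoint₁₃ {d} d∈₁ d∈₃ with _ , hi ← sound₁ d∈₁ | lo , _ ← sound₃ d∈₃ =
    absurd (2 * t) (hi ⊕ lo) (solve (t ∷ d ∷ []))

  disjoint₂₃ : ∀ {d} → d ∈ S₂ → d ∈ S₃ → ⊥
  disjoint₂₃ {d} d∈₂ d∈₃ with lo , hi ← sound₃ d∈₃ | sound₂ d∈₂
  ... | inj₁ (_ , hi′) = absurd 0 (hi′ ⊕ lo) (solve (t ∷ d ∷ []))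
  ... | inj₂ (lo′ , _) = absurd 0 (hi ⊕ lo′) (solve (t ∷ d ∷ []))

  valid : ∀ {S} → (∀ {d} → d ∈ S → Small d) → ValidConnSet (1 + 18 * t) S
  valid small = All.tabulate λ d∈ → let 1≤d , d≤9t = small d∈ in 1≤d , ≤-trans d≤9t 9t≤n/2
    where
    open ≤-Reasoning
    double : 9 * t * 2 ≤ 1 + 18 * t
    double = by 1 (z≤n {0}) (solve (t ∷ []))
    9t≤n/2 : 9 * t ≤ (1 + 18 * t) / 2
    9t≤n/2 = begin
      9 * t             ≡⟨ m*n/n≡m (9 * t) 2 ⟨
      9 * t * 2 / 2     ≤⟨ /-monoˡ-≤ 2 double ⟩
      (1 + 18 * t) / 2  ∎

  irreflexive : ∀ {S} → (∀ {d} → d ∈ S → Small d) → ∀ x y →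
    Circle (1 + 18 * t) S x y → Complete (1 + 18 * t) x y
  irreflexive small x .x c refl = n≮0 (subst (1 ≤_) (diffMod-self x) ([ proj₁ , proj₁ ]′ (Sum.map small small c)))

  -- The two differences of a pair add up to n = 18t + 1, so they are not both at most 9t. A common
  -- edge therefore puts one and the same difference into both sets.
  disjoint : ∀ {S S′} → (∀ {d} → d ∈ S → Small d) → (∀ {d} → d ∈ S′ → Small d) →
    (∀ {d} → d ∈ S → d ∈ S′ → ⊥) → ∀ x y → ¬ (Circle (1 + 18 * t) S x y × Circle (1 + 18 * t) S′ x y)
  disjoint {S} {S′} small small′ disj x y (c , c′) = go (c , c′)
    where
    sum≢n : ∀ {d d′} → Small d → Small d′ → d + d′ ≢ 1 + 18 * t
    sum≢n {d} {d′} (_ , hi) (_ , hi′) eq = absurd 0 (hi ⊕ hi′ ⊕ ≤-reflexive (sym eq)) (solve (t ∷ d ∷ d′ ∷ []))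
    sum≡n : diffMod (1 + 18 * t) x y + diffMod (1 + 18 * t) y x ≡ 1 + 18 * t
    sum≡n = diffMod-sum (irreflexive small x y c)
    go : ¬ (Circle (1 + 18 * t) S x y × Circle (1 + 18 * t) S′ x y)
    go (inj₁ d∈ , inj₁ d∈′) = disj d∈ d∈′
    go (inj₁ d∈ , inj₂ d∈′) = sum≢n (small d∈) (small′ d∈′) sum≡n
    go (inj₂ d∈ , inj₁ d∈′) = sum≢n (small′ d∈′) (small d∈) sum≡n
    go (inj₂ d∈ , inj₂ d∈′) = disj d∈ d∈′

  -- One of the two differences, which add up to n, is at most 9t, and `cover` places it.
  complete : ∀ x y → Complete (1 + 18 * t) x y →
    Circle (1 + 18 * t) S₁ x y ⊎ Circle (1 + 18 * t) S₂ x y ⊎ Circle (1 + 18 * t) S₃ x y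
  complete x y x≢y with diffMod (1 + 18 * t) x y ≤? 9 * t
  ... | yes d≤ = Sum.map inj₁ (Sum.map inj₁ inj₁) (cover (positive , d≤))
    where
    positive : 0 < diffMod (1 + 18 * t) x y
    positive = +-cancelʳ-< (diffMod (1 + 18 * t) y x) _ _
      (subst (diffMod (1 + 18 * t) y x <_) (sym (diffMod-sum x≢y)) (diffMod<n y x))
  ... | no  d≰ = Sum.map inj₂ (Sum.map inj₂ inj₂) (cover (positive , small _ _ (diffMod-sum x≢y) (≰⇒> d≰)))
    where
    positive : 0 < diffMod (1 + 18 * t) y x
    positive = +-cancelˡ-< (diffMod (1 + 18 * t) x y) _ _
      (subst₂ _<_ (sym (+-identityʳ _)) (sym (diffMod-sum x≢y)) (diffMod<n x y))
    small : ∀ d d′ → d + d′ ≡ 1 + 18 * t → 9 * t < d → d′ ≤ 9 * t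
    small d d′ eq d> = by 0 (≤-reflexive eq ⊕ d>) (solve (t ∷ d ∷ d′ ∷ []))

-- Assembling the decomposition

Decomposition : ℕ → ℕ → Set₁
Decomposition a m =
  Σ (List ℕ) λ S₁ → Σ (List ℕ) λ S₂ → Σ (List ℕ) λ S₃ →
  ValidConnSet (1 + a) S₁ × ValidConnSet (1 + a) S₂ × ValidConnSet (1 + a) S₃ ×
  EdgePartition3 (Complete (1 + a)) (Circle (1 + a) S₁) (Circle (1 + a) S₂) (Circle (1 + a) S₃) ×
  MaxDiam2AtMost (Circle (1 + a) S₁) m ×
  MaxDiam2AtMost (Circle (1 + a) S₂) m ×
  MaxDiam2AtMost (Circle (1 + a) S₃) m

decomposition : ∀ t → 1 ≤ t → Decomposition (18 * t) (6 * t + 3)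
decomposition t 1≤t =
    S₁ t , S₂ t , S₃ t
  , valid t (small₁ t) , valid t (small₂ t) , valid t (small₃ t)
  , ( irreflexive t (small₁ t) , irreflexive t (small₂ t) , irreflexive t (small₃ t) , complete t
    , disjoint t (small₁ t) (small₂ t) (disjoint₁₂ t)
    , disjoint t (small₁ t) (small₃ t) (disjoint₁₃ t)
    , disjoint t (small₂ t) (small₃ t) (disjoint₂₃ t))
  , circle-bound t (λ d∈ → proj₁ (small₁ t d∈)) (sound₁ t) (λ χ χ≤1 periodic → bound₁ t χ χ≤1 periodic 1≤t)
  , circle-bound t (λ d∈ → proj₁ (small₂ t d∈)) (sound₂ t) (λ χ χ≤1 periodic → bound₂ t χ χ≤1 periodic 1≤t)
  , circle-bound t (λ d∈ → proj₁ (small₃ t d∈)) (sound₃ t) (λ χ χ≤1 periodic → bound₃ t χ χ≤1 periodic 1≤t)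

theorem2 : (s : ℕ) → 9 ≤ s → 3 ∣ s →
    Σ (List ℕ) λ S₁ → Σ (List ℕ) λ S₂ → Σ (List ℕ) λ S₃ →
    ValidConnSet (1 + 6 * s) S₁ × ValidConnSet (1 + 6 * s) S₂ × ValidConnSet (1 + 6 * s) S₃ ×
    EdgePartition3 (Complete (1 + 6 * s)) (Circle (1 + 6 * s) S₁) (Circle (1 + 6 * s) S₂) (Circle (1 + 6 * s) S₃) ×
    MaxDiam2AtMost (Circle (1 + 6 * s) S₁) (2 * s + 3) ×
    MaxDiam2AtMost (Circle (1 + 6 * s) S₂) (2 * s + 3) ×
    MaxDiam2AtMost (Circle (1 + 6 * s) S₃) (2 * s + 3)
theorem2 s 9≤s (divides t refl) =
  -- Here s = t * 3. `Decomposition` takes n - 1, so the modulus `1 + a` stays visibly nonzero while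
  -- the numbers are rewritten.
  subst₂ Decomposition {18 * t} {6 * (t * 3)} {6 * t + 3} {2 * (t * 3) + 3}
    (solve (t ∷ [])) (solve (t ∷ [])) (decomposition t (1≤t t 9≤s))
  where
  1≤t : ∀ t → 9 ≤ t * 3 → 1 ≤ t
  1≤t (suc t) _ = s≤s z≤n
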